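{- Let $H$ be an $r$-segment hypergraph. (a) If $r=2$, then $\chi(H) \le 4$. (b) If $r=3$, then $\chi(H) \le 3$. (c) If $r \ge 4$, then $\chi(H) = 2$. Additionally, the inequalities in (a) and (b) are sharp.
   Context: A hypergraph $H=(V,E)$ consists of a vertex set $V$ and an edge set $E \subset 2^V$. For an integer $r \ge 2$, a hypergraph $H=(V,E)$ with $V \subset \mathbb{Z}^2$ is an $r$-segment hypergraph if (i) every edge in $E$ consists of $r$ consecutive integer points (points of $\mathbb{Z}^2$) on some line in $\mathbb{R}^2$, and (ii) every line in $\mathbb{R}^2$ contains at most one edge of $H$. A hypergraph is $k$-colorable, for a positive integer $k$, if one can assign one of $k$ colors to each vertex in such a way that no edge is monochromatic; the chromatic number $\chi(H)$ is the least $k$ such that $H$ is $k$-colorable. Sharpness of (a) and (b) means that there is a $2$-segment hypergraph with chromatic number $4$ and a $3$-segment hypergraph with chromatic number $3$.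
   Formalization: In (c), the equality χ(H) = 2 is stated for hypergraphs with at least one edge (an edgeless hypergraph satisfies the definition and has χ(H) = 1); χ(H) ≤ 2 is stated for all H. -}

module Defs where

open import Data.Nat as ℕ using (ℕ)
open import Data.Integer using (ℤ; 0ℤ; _+_; _-_; _*_; _<_)
open import Data.Fin using (Fin)
open import Data.List using (List; length)
open import Data.List.Membership.Propositional using () renaming (_∈_ to _∈ₗ_)
open import Data.List.Relation.Unary.All using (All)
open import Data.List.Relation.Unary.Linked using (Linked)
open import Data.Product using (_×_; _,_; ∃-syntax)
open import Level using (0ℓ)
open import Relation.Binary.PropositionalEquality using (_≡_)
open import Relation.Nullary using (¬_)
open import Relation.Unary using (Pred; _∈_; _⊆_; _≐_)

-- Subsets are predicates, compared by _≐_.  Vertex and edge sets may be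
-- infinite, and no decidability is assumed.
record Hypergraph (A : Set) : Set₁ where
  field
    V      : Pred A 0ℓ
    E      : Pred (Pred A 0ℓ) 0ℓ
    E-resp : ∀ {e e′} → e ≐ e′ → e ∈ E → e′ ∈ E
    E⊆2^V  : ∀ {e} → e ∈ E → e ⊆ V

module _ {A : Set} (H : Hypergraph A) where
  open Hypergraph H

  -- Membership is irrelevant, so a colour depends on the vertex alone.
  Coloring : ℕ → Set
  Coloring k = (v : A) → .(v ∈ V) → Fin k

  Monochromatic : ∀ {k e} → Coloring k → e ∈ E → Set
  Monochromatic {k} {e} c e∈E =
    ∃[ i ] (∀ {v} (v∈e : v ∈ e) → c v (E⊆2^V e∈E v∈e) ≡ i)

  Colorable : ℕ → Set₁
  Colorable k =
    ∃[ c ] (∀ {e} (e∈E : e ∈ E) → ¬ Monochromatic {k} c e∈E)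

χ[_]≡_ : {A : Set} → Hypergraph A → ℕ → Set₁
χ[ H ]≡ k =
  1 ℕ.≤ k × Colorable H k × (∀ j → 1 ℕ.≤ j → Colorable H j → k ℕ.≤ j)

-- For an arbitrary hypergraph the least k cannot be computed, so its existence
-- is asserted classically (under ¬ ¬); the n-colouring itself is demanded
-- outright.  With excluded middle this is exactly "χ(H) exists and is ≤ n".
χ[_]≤_ : {A : Set} → Hypergraph A → ℕ → Set₁
χ[ H ]≤ n = Colorable H n × ¬ ¬ (∃[ k ] (χ[ H ]≡ k × k ℕ.≤ n))

ℤ² : Set
ℤ² = ℤ × ℤ

-- The line a x + b y = c.  Every line of ℝ² through at least two integer
-- points has such an equation with integer coefficients; lines through fewer
-- integer points cannot contain an edge of r ≥ 2 integer points.
record Line : Set where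
  field
    a b c         : ℤ
    nondegenerate : ¬ (a ≡ 0ℤ × b ≡ 0ℤ)

module _ (ℓ : Line) where
  open Line ℓ

  -- The set of integer points of ℓ.
  On : Pred ℤ² 0ℓ
  On (x , y) = a * x + b * y ≡ c

  -- Inner product with the direction vector (b , - a): on points of ℓ,
  -- comparing positions is comparing along ℓ.
  position : ℤ² → ℤ
  position (x , y) = b * x - a * y

  -- q is the integer point of ℓ immediately after p.
  Next : ℤ² → ℤ² → Set
  Next p q =
    position p < position q ×
    (∀ z → On z → ¬ (position p < position z × position z < position q))

  ConsecutivePoints : ℕ → Pred ℤ² 0ℓ → Set
  ConsecutivePoints r e =
    ∃[ ps ] (length ps ≡ r × All On ps × Linked Next ps × e ≐ (_∈ₗ ps))

record IsSegmentHypergraph (r : ℕ) (H : Hypergraph ℤ²) : Set₁ where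
  open Hypergraph H
  field
    r≥2         : 2 ℕ.≤ r
    consecutive : ∀ {e} → e ∈ E → ∃[ ℓ ] ConsecutivePoints ℓ r e
    atMostOne   : ∀ ℓ {e e′} → e ∈ E → e′ ∈ E → e ⊆ On ℓ → e′ ⊆ On ℓ → e ≐ e′

{-# OPTIONS --safe #-}

-- The points of an edge are p, p + d, p + 2d, … with d divisible by no q ≥ 2,
-- since otherwise p + d/q would lie between p and p + d.  Hence the upper bounds
-- only require doubly periodic colourings that break every progression
-- with such a d, a finite check: period 2 for r = 2, period 3 for r = 3 and
-- period 4 (using only that 2 does not divide d) for r ≥ 4.
-- The bounds are sharp because of the unit square with its diagonals, which is
-- a K₄, and because of a system of 17 triples in a 5 × 5 grid, which has no proper
-- 2-colouring by a backtracking search.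
module Submission where

open import Data.Empty using (⊥)
open import Data.Fin as Fin using (Fin; toℕ; fromℕ<; inject≤)
open import Data.Fin.Patterns using (0F; 1F; 2F; 3F)
import Data.Fin.Properties as Fin
open import Data.Integer as ℤ
  using (ℤ; +_; -[1+_]; 0ℤ; 1ℤ; _+_; _-_; _*_; -_; _<_; ∣_∣; +≤+; +<+; NonNegative; nonNegative; positive)
open import Data.Integer.Divisibility.Signed
  using (_∣_; divides; _∣?_; ∣⇒∣ᵤ; ∣ᵤ⇒∣; ∣m∣n⇒∣m+n; ∣m⇒∣m*n)
open import Data.Integer.DivMod using (_%ℕ_; _/ℕ_; n%ℕd<d; a≡a%ℕn+[a/ℕn]*n)
open import Data.Integer.Properties
open import Data.Integer.Tactic.RingSolver using (solve-∀)
open import Data.List using (List; []; _∷_; length; map)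
open import Data.List.Membership.DecPropositional using () renaming (_∈?_ to [_]_∈?_)
open import Data.List.Membership.Propositional using (_∈_; find; lose)
open import Data.List.Properties using () renaming (≡-dec to ≡-decList)
open import Data.List.Relation.Unary.All as All using (All; []; _∷_)
import Data.List.Relation.Unary.All.Properties as All
open import Data.List.Relation.Unary.Any as Any using (Any)
import Data.List.Relation.Unary.Any.Properties as Any
open import Data.List.Relation.Unary.Linked using (Linked; []; [-]; _∷_)
open import Data.Nat as ℕ using (ℕ; zero; suc; _≤_; s≤s; z≤n)
import Data.Nat.Divisibility as ℕ
open import Data.Nat.Induction using (<-rec)
import Data.Nat.Properties as ℕ
open import Data.Product using (_×_; _,_; proj₁; proj₂; ∃-syntax)
open import Data.Product.Properties using () renaming (≡-dec to ≡-dec×)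
open import Data.Sum using (_⊎_; inj₁; inj₂)
open import Data.Unit using (tt)
open import Data.Vec using (Vec; lookup; []; _∷_)
open import Function using (_∘_)
open import Level using (0ℓ)
open import Relation.Binary using (DecidableEquality)
open import Relation.Binary.PropositionalEquality
open import Relation.Nullary
  using (Dec; yes; no; ¬_; ¬?; _×-dec_; _⊎-dec_; contradiction; from-yes)
open import Relation.Unary using (Pred; U; Satisfiable; _≐_)
open import Relation.Unary.Properties using (≐-sym; ≐-trans)
open import Defs

-- Vector arithmetic in ℤ² and arithmetic progressions of points.

infixl 6 _⊕_ _⊝_
infixl 7 _·_

_⊕_ _⊝_ : ℤ² → ℤ² → ℤ²
(x , y) ⊕ (u , v) = x + u , y + v
(x , y) ⊝ (u , v) = x - u , y - v

_·_ : ℤ → ℤ² → ℤ²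
n · (u , v) = n * u , n * v

infix 4 _∣²_

_∣²_ : ℕ → ℤ² → Set
n ∣² (u , v) = ((+ n) ∣ u) × ((+ n) ∣ v)

segment : ℕ → ℤ² → ℤ² → List ℤ²
segment zero    p d = []
segment (suc n) p d = p ∷ segment n (p ⊕ d) d

⊕-⊝ : ∀ p q → p ⊕ (q ⊝ p) ≡ q
⊕-⊝ (x , y) (u , v) = cong₂ _,_ (lemma x u) (lemma y v)
  where
  lemma : ∀ x u → x + (u - x) ≡ u
  lemma = solve-∀

⊕-⊝-cancel : ∀ p d → (p ⊕ d) ⊝ p ≡ d
⊕-⊝-cancel (x , y) (u , v) = cong₂ _,_ (lemma x u) (lemma y v)
  where
  lemma : ∀ x u → x + u - x ≡ u
  lemma = solve-∀

0≤i*i : ∀ i → 0ℤ ℤ.≤ i * i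
0≤i*i (+ n)    = subst (0ℤ ℤ.≤_) (pos-* n n) (+≤+ z≤n)
0≤i*i -[1+ n ] = +≤+ z≤n

i*i+j*j≡0⇒i≡0 : ∀ i j → i * i + j * j ≡ 0ℤ → i ≡ 0ℤ
i*i+j*j≡0⇒i≡0 i j eq with i*j≡0⇒i≡0∨j≡0 i {i} i*i≡0
  where
  i*i≡0 : i * i ≡ 0ℤ
  i*i≡0 = ≤-antisym
    (subst₂ ℤ._≤_ (+-identityʳ _) eq (+-monoʳ-≤ (i * i) (0≤i*i j))) (0≤i*i i)
... | inj₁ i≡0 = i≡0
... | inj₂ i≡0 = i≡0

i<j⇒0<j-i : ∀ {i j} → i < j → 0ℤ < j - i
i<j⇒0<j-i {i} {j} i<j = subst (_< j - i) (+-inverseʳ i) (+-monoˡ-< (- i) i<j)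

i<i+j : ∀ i {j} → 0ℤ < j → i < i + j
i<i+j i {j} 0<j = subst (_< i + j) (+-identityʳ i) (+-monoʳ-< i 0<j)

-- Consecutive integer points on a line.

module _ (ℓ : Line) where
  open Line ℓ

  Parallel : ℤ² → Set
  Parallel (u , v) = a * u + b * v ≡ 0ℤ

  position-⊕ : ∀ p w → position ℓ (p ⊕ w) ≡ position ℓ p + position ℓ w
  position-⊕ (x , y) (u , v) = lemma a b x y u v
    where
    lemma : ∀ a b x y u v → b * (x + u) - a * (y + v) ≡ b * x - a * y + (b * u - a * v)
    lemma = solve-∀

  position-⊝ : ∀ p q → position ℓ (q ⊝ p) ≡ position ℓ q - position ℓ p
  position-⊝ (x , y) (u , v) = lemma a b x y u v
    where
    lemma : ∀ a b x y u v → b * (u - x) - a * (v - y) ≡ b * u - a * v - (b * x - a * y)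
    lemma = solve-∀

  ⊕-on : ∀ {p w} → On ℓ p → Parallel w → On ℓ (p ⊕ w)
  ⊕-on {x , y} {u , v} p∈ℓ w∥ℓ = trans (lemma a b x y u v)
    (trans (cong₂ _+_ p∈ℓ w∥ℓ) (+-identityʳ c))
    where
    lemma : ∀ a b x y u v → a * (x + u) + b * (y + v) ≡ a * x + b * y + (a * u + b * v)
    lemma = solve-∀

  ⊝-parallel : ∀ {p q} → On ℓ p → On ℓ q → Parallel (q ⊝ p)
  ⊝-parallel {x , y} {u , v} p∈ℓ q∈ℓ = trans (lemma a b x y u v)
    (trans (cong₂ _-_ q∈ℓ p∈ℓ) (+-inverseʳ c))
    where
    lemma : ∀ a b x y u v → a * (u - x) + b * (v - y) ≡ a * u + b * v - (a * x + b * y)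
    lemma = solve-∀

  a²+b²≢0 : ¬ a * a + b * b ≡ 0ℤ
  a²+b²≢0 eq = nondegenerate
    (i*i+j*j≡0⇒i≡0 a b eq , i*i+j*j≡0⇒i≡0 b a (trans (+-comm (b * b) (a * a)) eq))

  line-cancel : ∀ x → a * x ≡ 0ℤ → b * x ≡ 0ℤ → x ≡ 0ℤ
  line-cancel x ax≡0 bx≡0 with i*j≡0⇒i≡0∨j≡0 a ax≡0 | i*j≡0⇒i≡0∨j≡0 b bx≡0
  ... | inj₂ x≡0 | _        = x≡0
  ... | inj₁ _   | inj₂ x≡0 = x≡0
  ... | inj₁ a≡0 | inj₁ b≡0 = contradiction (a≡0 , b≡0) nondegenerate

  -- The vector `p ⊝ q` is killed by the forms with coefficients `(a , b)` and `(b , - a)`. Their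
  -- determinant is `a * a + b * b` up to sign, hence nonzero, and Cramer's rule makes both
  -- coordinates vanish.
  position-injective : ∀ {p q} → On ℓ p → On ℓ q → position ℓ p ≡ position ℓ q → p ≡ q
  position-injective {p@(x , y)} {q@(u , v)} p∈ℓ q∈ℓ eq =
    cong₂ _,_ (equal x u fst) (equal y v snd)
    where
    par : a * (x - u) + b * (y - v) ≡ 0ℤ
    par = ⊝-parallel {q} {p} q∈ℓ p∈ℓ

    pos : b * (x - u) - a * (y - v) ≡ 0ℤ
    pos = trans (position-⊝ q p) (i≡j⇒i-j≡0 eq)

    vanish : ∀ α β → α * (a * (x - u) + b * (y - v)) + β * (b * (x - u) - a * (y - v)) ≡ 0ℤ
    vanish α β = cong₂ _+_ (trans (cong (α *_) par) (*-zeroʳ α))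
                           (trans (cong (β *_) pos) (*-zeroʳ β))

    fst : (a * a + b * b) * (x - u) ≡ 0ℤ
    fst = trans (lemma a b (x - u) (y - v)) (vanish a b)
      where
      lemma : ∀ a b s t → (a * a + b * b) * s ≡ a * (a * s + b * t) + b * (b * s - a * t)
      lemma = solve-∀

    snd : (a * a + b * b) * (y - v) ≡ 0ℤ
    snd = trans (lemma a b (x - u) (y - v)) (vanish b (- a))
      where
      lemma : ∀ a b s t → (a * a + b * b) * t ≡ b * (a * s + b * t) + (- a) * (b * s - a * t)
      lemma = solve-∀

    equal : ∀ s t → (a * a + b * b) * (s - t) ≡ 0ℤ → s ≡ t
    equal s t e with i*j≡0⇒i≡0∨j≡0 (a * a + b * b) e
    ... | inj₁ n≡0 = contradiction n≡0 a²+b²≢0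
    ... | inj₂ d≡0 = i-j≡0⇒i≡j s t d≡0

  -- Translate one gap onto the other. If the gap from `q` to `r` were the longer one, `q ⊕ (q ⊝ p)`
  -- would lie strictly between `q` and `r`; if it were the shorter one, `p ⊕ (r ⊝ q)` would lie
  -- strictly between `p` and `q`.
  next-equispaced : ∀ {p q r} → On ℓ p → On ℓ q → On ℓ r →
                    Next ℓ p q → Next ℓ q r → r ⊝ q ≡ q ⊝ p
  next-equispaced {p} {q} {r} p∈ℓ q∈ℓ r∈ℓ (p<q , ∄pq) (q<r , ∄qr) =
    trans (cong (_⊝ q) r≡) (⊕-⊝-cancel q (q ⊝ p))
    where
    P Q R : ℤ
    P = position ℓ p
    Q = position ℓ q
    R = position ℓ r

    before after : ℤ²
    before = p ⊕ (r ⊝ q)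
    after  = q ⊕ (q ⊝ p)

    after∈ℓ : On ℓ after
    after∈ℓ = ⊕-on {q} {q ⊝ p} q∈ℓ (⊝-parallel {p} {q} p∈ℓ q∈ℓ)

    before≡ : position ℓ before ≡ P + (R - Q)
    before≡ = trans (position-⊕ p (r ⊝ q)) (cong (_+_ P) (position-⊝ q r))

    after≡ : position ℓ after ≡ Q + (Q - P)
    after≡ = trans (position-⊕ q (q ⊝ p)) (cong (_+_ Q) (position-⊝ p q))

    R≤ : R ℤ.≤ Q + (Q - P)
    R≤ = ≮⇒≥ λ after<R → ∄qr after after∈ℓ
      ( subst (Q <_) (sym after≡) (i<i+j Q (i<j⇒0<j-i p<q))
      , subst (_< R) (sym after≡) after<R )

    R≥ : Q + (Q - P) ℤ.≤ R
    R≥ = ≮⇒≥ λ R<after → ∄pq before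
      (⊕-on {p} {r ⊝ q} p∈ℓ (⊝-parallel {q} {r} q∈ℓ r∈ℓ))
      ( subst (P <_) (sym before≡) (i<i+j P (i<j⇒0<j-i q<r))
      , subst₂ _<_ (trans (shift P Q R) (sym before≡)) (cancel P Q) (+-monoʳ-< (P - Q) R<after) )
      where
      shift : ∀ P Q R → P - Q + R ≡ P + (R - Q)
      shift = solve-∀
      cancel : ∀ P Q → P - Q + (Q + (Q - P)) ≡ Q
      cancel = solve-∀

    r≡ : r ≡ after
    r≡ = position-injective {r} {after} r∈ℓ after∈ℓ (trans (≤-antisym R≤ R≥) (sym after≡))

  linked⇒segment : ∀ {p q ps} → All (On ℓ) (p ∷ q ∷ ps) → Linked (Next ℓ) (p ∷ q ∷ ps) →
                   p ∷ q ∷ ps ≡ segment (length (p ∷ q ∷ ps)) p (q ⊝ p)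
  linked⇒segment {p} {q} {[]} _ _ = cong (λ z → p ∷ z ∷ []) (sym (⊕-⊝ p q))
  linked⇒segment {p} {q} {r ∷ ps} (p∈ℓ ∷ on@(q∈ℓ ∷ r∈ℓ ∷ _)) (pq ∷ linked@(qr ∷ _)) =
    cong (p ∷_) (trans (linked⇒segment on linked)
      (cong₂ (segment _) (sym (⊕-⊝ p q)) (next-equispaced {p} {q} {r} p∈ℓ q∈ℓ r∈ℓ pq qr)))

  next-indivisible : ∀ {p d n} → On ℓ p → On ℓ (p ⊕ d) → Next ℓ p (p ⊕ d) → 1 ℕ.< n →
                     ¬ (n ∣² d)
  next-indivisible {p} {_ , _} {n} p∈ℓ q∈ℓ (p<q , ∄pq) 1<n
                   (divides u refl , divides v refl) =
    ∄pq (p ⊕ w) (⊕-on {p} {w} p∈ℓ w∥ℓ)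
      ( subst (position ℓ p <_) (sym (position-⊕ p w)) (i<i+j _ 0<w)
      , subst₂ _<_ (sym (position-⊕ p w)) (sym end≡) (+-monoʳ-< (position ℓ p) w<nw) )
    where
    open ≡-Reasoning
    w : ℤ²
    w = u , v

    instance
      n≢0 : ℕ.NonZero n
      n≢0 = ℕ.>-nonZero (ℕ.<-trans ℕ.z<s 1<n)

    end≡ : position ℓ (p ⊕ (u * + n , v * + n)) ≡ position ℓ p + + n * position ℓ w
    end≡ = trans (position-⊕ p _) (cong (_+_ (position ℓ p)) (lemma a b (+ n) u v))
      where
      lemma : ∀ a b n u v → b * (u * n) - a * (v * n) ≡ n * (b * u - a * v)
      lemma = solve-∀

    -- Subtracting the equations of the line at the two end points leaves `n` times the equation
    -- wanted for `w`, and `n` cancels.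
    w∥ℓ : Parallel w
    w∥ℓ = *-cancelʳ-≡ _ 0ℤ (+ n) (begin
      (a * u + b * v) * + n             ≡⟨ lemma a b (+ n) u v (proj₁ p) (proj₂ p) ⟩
      a * (proj₁ p + u * + n) + b * (proj₂ p + v * + n) - (a * proj₁ p + b * proj₂ p)
                                        ≡⟨ cong₂ _-_ q∈ℓ p∈ℓ ⟩
      c - c                             ≡⟨ +-inverseʳ c ⟩
      0ℤ                                ∎)
      where
      lemma : ∀ a b n u v x y → (a * u + b * v) * n ≡
              a * (x + u * n) + b * (y + v * n) - (a * x + b * y)
      lemma = solve-∀

    0<w : 0ℤ < position ℓ w
    0<w = *-cancelˡ-<-nonNeg (+ n) (subst₂ _<_ (sym (*-zeroʳ (+ n)))
      (trans (cong (_- position ℓ p) end≡) (lemma (position ℓ p) (+ n * position ℓ w))) (i<j⇒0<j-i p<q))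
      where
      lemma : ∀ x y → x + y - x ≡ y
      lemma = solve-∀

    w<nw : position ℓ w < + n * position ℓ w
    w<nw = subst (_< + n * position ℓ w) (*-identityˡ _)
      (*-monoʳ-<-pos (position ℓ w) {{positive 0<w}} (+<+ 1<n))

-- Doubly periodic colourings and their finite check.

remainder-unique : ∀ {m r s} q t → r ℕ.< m → s ℕ.< m →
                   + r + q * + m ≡ + s + t * + m → r ≡ s
remainder-unique {m} {r} {s} q t r<m s<m eq =
  +-injective (i-j≡0⇒i≡j (+ r) (+ s) (∣i∣≡0⇒i≡0 (small _ bound m∣)))
  where
  open ≡-Reasoning

  m∣ : m ℕ.∣ ∣ + r - + s ∣
  m∣ = ∣⇒∣ᵤ (divides (t - q) (begin
    + r - + s                                ≡⟨ add (+ r) (+ s) (q * + m) ⟩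
    + r + q * + m - (+ s + q * + m)          ≡⟨ cong (_- (+ s + q * + m)) eq ⟩
    + s + t * + m - (+ s + q * + m)          ≡⟨ collect (+ s) q t (+ m) ⟩
    (t - q) * + m                            ∎))
    where
    add : ∀ r s x → r - s ≡ r + x - (s + x)
    add = solve-∀
    collect : ∀ s q t m → s + t * m - (s + q * m) ≡ (t - q) * m
    collect = solve-∀

  bound : ∣ + r - + s ∣ ℕ.< m
  bound = ℕ.≤-<-trans
    (subst (_≤ r ℕ.⊔ s) (cong ∣_∣ (sym ([+m]-[+n]≡m⊖n r s))) (∣m⊝n∣≤m⊔n r s))
    (ℕ.⊔-lub r<m s<m)

  small : ∀ n → n ℕ.< m → m ℕ.∣ n → n ≡ 0
  small zero    _   _   = refl
  small (suc n) n<m m∣n = contradiction m∣n (ℕ.>⇒∤ n<m)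

%ℕ-periodic : ∀ m .{{_ : ℕ.NonZero m}} x w → (x + + m * w) %ℕ m ≡ x %ℕ m
%ℕ-periodic m x w = remainder-unique (y /ℕ m) (x /ℕ m + w) (n%ℕd<d y m) (n%ℕd<d x m) (begin
  + (y %ℕ m) + (y /ℕ m) * + m            ≡⟨ a≡a%ℕn+[a/ℕn]*n y m ⟨
  x + + m * w                            ≡⟨ cong (_+ + m * w) (a≡a%ℕn+[a/ℕn]*n x m) ⟩
  + (x %ℕ m) + x /ℕ m * + m + + m * w    ≡⟨ lemma (+ (x %ℕ m)) (x /ℕ m) (+ m) w ⟩
  + (x %ℕ m) + (x /ℕ m + w) * + m        ∎)
  where
  open ≡-Reasoning
  y : ℤ
  y = x + + m * w
  lemma : ∀ r q m w → r + q * m + m * w ≡ r + (q + w) * m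
  lemma = solve-∀

residue : ∀ m .{{_ : ℕ.NonZero m}} → ℤ → Fin m
residue m x = fromℕ< (n%ℕd<d x m)

residue-periodic : ∀ m .{{_ : ℕ.NonZero m}} x w → residue m (x + + m * w) ≡ residue m x
residue-periodic m x w = Fin.fromℕ<-cong _ _ (%ℕ-periodic m x w) _ _

grid : ∀ {m} → Fin m → Fin m → ℤ²
grid i j = + toℕ i , + toℕ j

residues : ∀ m .{{_ : ℕ.NonZero m}} p →
           ∃[ i ] ∃[ j ] ∃[ w ] p ≡ grid {m} i j ⊕ + m · w
residues m (x , y) = residue m x , residue m y , (x /ℕ m , y /ℕ m) , cong₂ _,_ (split x) (split y)
  where
  split : ∀ x → x ≡ + toℕ (residue m x) + + m * (x /ℕ m)
  split x = trans (a≡a%ℕn+[a/ℕn]*n x m)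
    (cong₂ _+_ (cong +_ (sym (Fin.toℕ-fromℕ< _))) (*-comm (x /ℕ m) (+ m)))

colour : ∀ {k m} .{{_ : ℕ.NonZero m}} → Vec (Vec (Fin k) m) m → ℤ² → Fin k
colour {m = m} table (x , y) = lookup (lookup table (residue m x)) (residue m y)

-- Start and step of a progression matter only modulo `m`, which leaves finitely many cases to
-- check.
map-segment-periodic : ∀ {k m} .{{_ : ℕ.NonZero m}} (table : Vec (Vec (Fin k) m) m) n p d p′ d′ →
  map (colour table) (segment n (p ⊕ + m · p′) (d ⊕ + m · d′)) ≡ map (colour table) (segment n p d)
map-segment-periodic table zero p d p′ d′ = refl
map-segment-periodic {m = m} table (suc n) p@(x , y) d@(u , v) p′@(x′ , y′) d′@(u′ , v′) = cong₂ _∷_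
  (cong₂ (λ i j → lookup (lookup table i) j) (residue-periodic m x x′) (residue-periodic m y y′))
  (trans (cong (λ z → map (colour table) (segment n z (d ⊕ + m · d′)))
               (cong₂ _,_ (lemma x u (+ m) x′ u′) (lemma y v (+ m) y′ v′)))
         (map-segment-periodic table n (p ⊕ d) d (p′ ⊕ d′) d′))
  where
  lemma : ∀ x u m x′ u′ → x + m * x′ + (u + m * u′) ≡ x + u + m * (x′ + u′)
  lemma = solve-∀

-- The first alternative sets aside the steps that cannot occur between consecutive points. The
-- divisor `q` is separate from the period `m` because they differ in the case of long edges.
Multicoloured : ∀ {k m} .{{_ : ℕ.NonZero m}} → Vec (Vec (Fin k) m) m → ℕ → ℕ → Set
Multicoloured {m = m} table q n = ∀ (i j u v : Fin m) → q ∣² grid u v ⊎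
  (∀ κ → ¬ All (_≡ κ) (map (colour table) (segment n (grid i j) (grid u v))))

multicoloured? : ∀ {k m} .{{_ : ℕ.NonZero m}} (table : Vec (Vec (Fin k) m) m) q n →
                 Dec (Multicoloured table q n)
multicoloured? table q n = Fin.all? λ i → Fin.all? λ j → Fin.all? λ u → Fin.all? λ v →
  (((+ q) ∣? (+ toℕ u)) ×-dec ((+ q) ∣? (+ toℕ v))) ⊎-dec
  (Fin.all? λ κ → ¬? (All.all? (Fin._≟ κ) (map (colour table) (segment n (grid i j) (grid u v)))))

All-segment-≤ : ∀ {P : Pred ℤ² 0ℓ} {m n p d} → m ≤ n → All P (segment n p d) → All P (segment m p d)
All-segment-≤ z≤n       _        = []
All-segment-≤ (s≤s m≤n) (px ∷ pxs) = px ∷ All-segment-≤ m≤n pxs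

-- An edge is a progression, and its first `n` points already show two colours, so one table serves
-- every `r` from `n` on.
multicoloured⇒colorable : ∀ {k m} .{{_ : ℕ.NonZero m}} (table : Vec (Vec (Fin k) m) m) {q n r} {H} →
  1 ℕ.< q → q ℕ.∣ m → Multicoloured table q n → n ≤ r → IsSegmentHypergraph r H → Colorable H k
multicoloured⇒colorable {m = m} table {q} {n} {r} {H} 1<q q∣m multi n≤r H-seg =
  (λ v _ → colour table v) , proper
  where
  open Hypergraph H
  open IsSegmentHypergraph H-seg

  proper : ∀ {e} (e∈E : E e) → ¬ Monochromatic H (λ v _ → colour table v) e∈E
  proper e∈E (κ , mono) with consecutive e∈E
  ... | ℓ , [] , refl , _ = contradiction r≥2 λ()
  ... | ℓ , _ ∷ [] , refl , _ = contradiction r≥2 λ where (s≤s ())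
  ... | ℓ , ps@(p ∷ p⁺ ∷ _) , refl , on@(p∈ℓ ∷ p⁺∈ℓ ∷ _) , linked@(p⋖p⁺ ∷ _) , _ , ps⊆e
    with i , j , w , p≡ ← residues m p | u , v , z , d≡ ← residues m (p⁺ ⊝ p)
    with multi i j u v
  -- As `q` divides `m`, divisibility of the residues by `q` lifts to the step itself.
  ... | inj₁ (q∣u , q∣v) = next-indivisible ℓ {p} {p⁺ ⊝ p} {q} p∈ℓ
          (subst (On ℓ) (sym (⊕-⊝ p p⁺)) p⁺∈ℓ) (subst (Next ℓ p) (sym (⊕-⊝ p p⁺)) p⋖p⁺) 1<q
          (subst (q ∣²_) (sym d≡)
            (∣m∣n⇒∣m+n q∣u (∣m⇒∣m*n _ q∣m′) , ∣m∣n⇒∣m+n q∣v (∣m⇒∣m*n _ q∣m′)))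
    where
    q∣m′ : (+ q) ∣ (+ m)
    q∣m′ = ∣ᵤ⇒∣ q∣m
  ... | inj₂ nonconstant = nonconstant κ
          (subst (All (_≡ κ)) (trans (cong₂ (λ x y → map (colour table) (segment n x y)) p≡ d≡)
                                     (map-segment-periodic table n _ _ w z))
            (All.map⁺ (All-segment-≤ n≤r
              (subst (All (λ x → colour table x ≡ κ)) (linked⇒segment ℓ on linked)
                (All.tabulate λ x∈ps → mono (ps⊆e x∈ps))))))

-- Chromatic numbers from colourability.

-- Suppose that no chromatic number up to `n` exists. By strong induction no positive `j ≤ n` admits
-- a colouring, since the first one to do so would be the chromatic number; this fails at `n`.
χ≤-from-colorable : ∀ {A} (H : Hypergraph A) {n} → 1 ≤ n → Colorable H n → χ[ H ]≤ n
χ≤-from-colorable H {n} 1≤n col = col , λ ∄χ →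
  <-rec (λ j → 1 ≤ j → Colorable H j → ¬ j ≤ n)
    (λ j rec 1≤j colⱼ j≤n → ∄χ (j ,
      (1≤j , colⱼ , λ i 1≤i colᵢ → ℕ.≮⇒≥ λ i<j →
        rec i<j 1≤i colᵢ (ℕ.≤-trans (ℕ.<⇒≤ i<j) j≤n)) , j≤n))
    n 1≤n col ℕ.≤-refl

Colorable-mono : ∀ {A} (H : Hypergraph A) {j k} → 1 ≤ j → j ≤ k → Colorable H j → Colorable H k
Colorable-mono H {j} {k} 1≤j j≤k (c , proper) =
  (λ v v∈V → inject≤ (c v v∈V) j≤k) ,
  λ e∈E (i , mono) → proper e∈E
    (retract i , λ v∈e → trans (sym (retract-inject≤ _)) (cong retract (mono v∈e)))
  where
  retract : Fin k → Fin j
  retract i with toℕ i ℕ.<? j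
  ... | yes i<j = fromℕ< i<j
  -- An arbitrary value: no vertex receives such a colour `i`, though an empty edge counts as
  -- monochromatic in it.
  ... | no  _   = fromℕ< 1≤j

  retract-inject≤ : ∀ i → retract (inject≤ i j≤k) ≡ i
  retract-inject≤ i with toℕ (inject≤ i j≤k) ℕ.<? j
  ... | yes i<j = Fin.toℕ-injective (trans (Fin.toℕ-fromℕ< i<j) (Fin.toℕ-inject≤ i j≤k))
  ... | no  i≮j = contradiction
          (subst (ℕ._< j) (sym (Fin.toℕ-inject≤ i j≤k)) (Fin.toℕ<n i)) i≮j

χ≡-from-colorable : ∀ {A} (H : Hypergraph A) {k} →
                    Colorable H (suc k) → ¬ Colorable H k → χ[ H ]≡ suc k
χ≡-from-colorable H col ¬col = s≤s z≤n , col , λ j 1≤j colⱼ →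
  ℕ.≰⇒> λ j≤k → ¬col (Colorable-mono H 1≤j j≤k colⱼ)

-- The lower bound in (c). It asks for an edge because an edgeless hypergraph has chromatic number
-- 1.
edge⇒¬1-colorable : ∀ {A} (H : Hypergraph A) → Satisfiable (Hypergraph.E H) → ¬ Colorable H 1
edge⇒¬1-colorable H (e , e∈E) (c , proper) = proper e∈E (0F , λ _ → unique _)
  where
  unique : (i : Fin 1) → i ≡ 0F
  unique 0F = refl

-- Segment hypergraphs from finite lists of segments.

infix 7 _•_

_•_ : ℤ² → ℤ² → ℤ
(u , v) • (s , t) = u * s + v * t

cross : ℤ² → ℤ² → ℤ
cross (u , v) (s , t) = u * t - v * s

-- A primitive vector. The Bézout coefficients certify that it is primitive and are used to compute
-- the multiple of it that separates two integer points of a line.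
record Direction : Set where
  constructor direction
  field
    vector bezout : ℤ²
    coprime       : vector • bezout ≡ 1ℤ

open Direction

Segment : Set
Segment = ℤ² × Direction

points : ℕ → Segment → List ℤ²
points r (p , D) = segment r p (vector D)

-- The normal is `(- v , u)`, with this sign so that `position` is the inner product with `(u , v)`
-- and increases along the segment.
lineThrough : ℤ² → Direction → Line
lineThrough (x , y) (direction (u , v) (s , t) coprime) = record
  { a = - v ; b = u ; c = (- v) * x + u * y
  ; nondegenerate = λ (-v≡0 , u≡0) → 1≢0 (trans (sym coprime)
      (cong₂ (λ u v → u * s + v * t) u≡0 (neg-injective {v} {0ℤ} -v≡0)))
  }
  where
  1≢0 : ¬ 1ℤ ≡ 0ℤ
  1≢0 ()

module _ (p : ℤ²) (D : Direction) where
  private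
    ℓ : Line
    ℓ = lineThrough p D

    d : ℤ²
    d = vector D

    norm : ℤ
    norm = d • d

  position-step : ∀ z → position ℓ (z ⊕ d) ≡ position ℓ z + norm
  position-step (x , y) = lemma x y (proj₁ d) (proj₂ d)
    where
    lemma : ∀ x y u v → u * (x + u) - (- v) * (y + v) ≡ u * x - (- v) * y + (u * u + v * v)
    lemma = solve-∀

  step-on : ∀ {z} → On ℓ z → On ℓ (z ⊕ d)
  step-on {z} z∈ℓ = ⊕-on ℓ {z} {d} z∈ℓ (lemma (proj₁ d) (proj₂ d))
    where
    lemma : ∀ u v → (- v) * u + u * v ≡ 0ℤ
    lemma = solve-∀

  0≤norm : 0ℤ ℤ.≤ norm
  0≤norm = +-mono-≤ (0≤i*i (proj₁ d)) (0≤i*i (proj₂ d))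

  norm≢0 : ¬ norm ≡ 0ℤ
  norm≢0 eq = a²+b²≢0 ℓ (trans (lemma (proj₁ d) (proj₂ d)) eq)
    where
    lemma : ∀ u v → (- v) * (- v) + u * u ≡ u * u + v * v
    lemma = solve-∀

  0<norm : 0ℤ < norm
  0<norm = ≤∧≢⇒< 0≤norm (norm≢0 ∘ sym)

  -- By Bézout, w ⊝ z is an integer multiple k of d, so the positions of
  -- integer points of ℓ differ by multiples of the norm of d.
  step-next : ∀ {z} → On ℓ z → Next ℓ z (z ⊕ d)
  step-next {z} z∈ℓ = subst (position ℓ z <_) (sym (position-step z)) (i<i+j _ 0<norm) ,
    λ w w∈ℓ (z<w , w<z⁺) → between (k w) (subst (0ℤ <_) (apart w w∈ℓ) (i<j⇒0<j-i z<w))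
      (subst₂ _<_ (apart w w∈ℓ) (trans (cong (_- position ℓ z) (position-step z))
        (cancel (position ℓ z) norm)) (+-monoˡ-< (- position ℓ z) w<z⁺))
    where
    cancel : ∀ x y → x + y - x ≡ y
    cancel = solve-∀

    k : ℤ² → ℤ
    k w = bezout D • (w ⊝ z)

    instance
      norm-nonNegative : NonNegative norm
      norm-nonNegative = nonNegative 0≤norm

    between : ∀ k → 0ℤ < k * norm → k * norm < norm → ⊥
    between k 0<kN kN<N = ≤⇒≯ (i<j⇒suc[i]≤j {0ℤ} {k} 0<k) k<1
      where
      0<k : 0ℤ < k
      0<k = *-cancelʳ-<-nonNeg norm 0<kN
      k<1 : k < 1ℤ
      k<1 = *-cancelʳ-<-nonNeg norm (subst (k * norm <_) (sym (*-identityˡ norm)) kN<N)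

    -- Writing 1 as `u * s + v * t` brings in the Bézout coefficients. The surplus term of `expand`
    -- contains `(- v) * f + u * g`, which is zero because `w ⊝ z` is parallel to the line.
    apart : ∀ w → On ℓ w → position ℓ w - position ℓ z ≡ k w * norm
    apart w w∈ℓ = begin
      position ℓ w - position ℓ z                       ≡⟨ position-⊝ ℓ z w ⟨
      u * f - (- v) * g                                 ≡⟨ unit u v f g ⟩
      1ℤ * (u * f + v * g)                              ≡⟨ cong (_* (u * f + v * g)) (coprime D) ⟨
      (u * s + v * t) * (u * f + v * g)                 ≡⟨ expand u v s t f g ⟩
      (s * f + t * g) * norm + (s * v - t * u) * ((- v) * f + u * g)
        ≡⟨ cong (λ x → (s * f + t * g) * norm + (s * v - t * u) * x) (⊝-parallel ℓ {z} {w} z∈ℓ w∈ℓ) ⟩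
      (s * f + t * g) * norm + (s * v - t * u) * 0ℤ     ≡⟨ drop _ (s * v - t * u) ⟩
      k w * norm                                        ∎
      where
      open ≡-Reasoning
      u v s t f g : ℤ
      u = proj₁ d
      v = proj₂ d
      s = proj₁ (bezout D)
      t = proj₂ (bezout D)
      f = proj₁ (w ⊝ z)
      g = proj₂ (w ⊝ z)
      unit : ∀ u v f g → u * f - (- v) * g ≡ 1ℤ * (u * f + v * g)
      unit = solve-∀
      expand : ∀ u v s t f g → (u * s + v * t) * (u * f + v * g) ≡
        (s * f + t * g) * (u * u + v * v) + (s * v - t * u) * ((- v) * f + u * g)
      expand = solve-∀
      drop : ∀ x y → x + y * 0ℤ ≡ x
      drop = solve-∀

  segment-on : ∀ n {z} → On ℓ z → All (On ℓ) (segment n z d)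
  segment-on zero    z∈ℓ = []
  segment-on (suc n) {z} z∈ℓ = z∈ℓ ∷ segment-on n (step-on {z} z∈ℓ)

  segment-linked : ∀ n {z} → On ℓ z → Linked (Next ℓ) (segment n z d)
  segment-linked zero          z∈ℓ = []
  segment-linked (suc zero)    z∈ℓ = [-]
  segment-linked (suc (suc n)) {z} z∈ℓ =
    step-next {z} z∈ℓ ∷ segment-linked (suc n) (step-on {z} z∈ℓ)

length-segment : ∀ n p d → length (segment n p d) ≡ n
length-segment zero    p d = refl
length-segment (suc n) p d = cong suc (length-segment n (p ⊕ d) d)

-- Both `a` and `b` times the determinant are combinations of the two parallelism equations, and
-- `a`, `b` are not both zero.
parallel-cross : ∀ ℓ {d w} → Parallel ℓ d → Parallel ℓ w → cross d w ≡ 0ℤ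
parallel-cross ℓ {u , v} {s , t} d∥ℓ w∥ℓ = line-cancel ℓ _
  (trans (lemma₁ a b u v s t) (vanish t (- v)))
  (trans (lemma₂ a b u v s t) (vanish (- s) u))
  where
  open Line ℓ
  vanish : ∀ α β → α * (a * u + b * v) + β * (a * s + b * t) ≡ 0ℤ
  vanish α β = cong₂ _+_ (trans (cong (α *_) d∥ℓ) (*-zeroʳ α))
                         (trans (cong (β *_) w∥ℓ) (*-zeroʳ β))

  lemma₁ : ∀ a b u v s t → a * (u * t - v * s) ≡ t * (a * u + b * v) + (- v) * (a * s + b * t)
  lemma₁ = solve-∀

  lemma₂ : ∀ a b u v s t → b * (u * t - v * s) ≡ (- s) * (a * u + b * v) + u * (a * s + b * t)
  lemma₂ = solve-∀

-- Edges are taken up to `≐`, which gives `E-resp`. Every point is a vertex, so a colouring is a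
-- function on the whole plane.
segmentHypergraph : ℕ → List Segment → Hypergraph ℤ²
segmentHypergraph r S = record
  { V      = U
  ; E      = λ e → Any (λ s → e ≐ (_∈ points r s)) S
  ; E-resp = λ e≐e′ → Any.map (≐-trans (≐-sym e≐e′))
  ; E⊆2^V  = λ _ _ → tt
  }

_≟²_ : DecidableEquality ℤ²
_≟²_ = ≡-dec× _≟_ _≟_

-- Points are compared instead of segments to avoid deciding equality of Bézout proofs.
Separated : ℕ → List Segment → Set
Separated r S = All (λ s → All (λ t → points r s ≡ points r t ⊎
  Any (λ z → ¬ cross (vector (proj₂ s)) (z ⊝ proj₁ s) ≡ 0ℤ) (points r t)) S) S

separated? : ∀ r S → Dec (Separated r S)
separated? r S = All.all? (λ s → All.all? (λ t → ≡-decList _≟²_ (points r s) (points r t) ⊎-dec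
  Any.any? (λ z → ¬? (cross (vector (proj₂ s)) (z ⊝ proj₁ s) ≟ 0ℤ)) (points r t)) S) S

-- A line containing one segment has cross product zero with it at every point, so a second segment
-- on that line cannot have a point off it and must be the same point list. This settles all lines
-- by one finite check.
isSegmentHypergraph : ∀ {r S} → 2 ≤ r → Separated r S → IsSegmentHypergraph r (segmentHypergraph r S)
isSegmentHypergraph {r} {S} 2≤r separated = record
  { r≥2         = 2≤r
  ; consecutive = λ e∈E → let (p , D) , e≐ = Any.satisfied e∈E in
      lineThrough p D , points r (p , D) , length-segment r p (vector D) ,
      segment-on p D r refl , segment-linked p D r refl , e≐
  ; atMostOne   = atMostOne
  }
  where
  collinear : ∀ ℓ s → All (On ℓ) (points r s) →
              ∀ {z} → On ℓ z → cross (vector (proj₂ s)) (z ⊝ proj₁ s) ≡ 0ℤ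
  -- Two points of the segment suffice: their difference is its direction vector.
  collinear ℓ (p , D) on {z} z∈ℓ with p∈ℓ ∷ q∈ℓ ∷ [] ← All-segment-≤ {p = p} {vector D} 2≤r on =
    parallel-cross ℓ {vector D} {z ⊝ p}
      (subst (Parallel ℓ) (⊕-⊝-cancel p (vector D)) (⊝-parallel ℓ {p} {p ⊕ vector D} p∈ℓ q∈ℓ))
      (⊝-parallel ℓ {p} {z} p∈ℓ z∈ℓ)

  atMostOne : ∀ ℓ {e e′} → Any (λ s → e ≐ (_∈ points r s)) S → Any (λ s → e′ ≐ (_∈ points r s)) S →
              (∀ {z} → e z → On ℓ z) → (∀ {z} → e′ z → On ℓ z) → e ≐ e′
  atMostOne ℓ e∈E e′∈E e⊆ℓ e′⊆ℓ
    with sep , (e⊆ , ⊆e) ← All.lookupAny separated e∈E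
    with sep′ , e′≐@(_ , ⊆e′) ← All.lookupAny sep e′∈E
    with sep′
  ... | inj₁ same = ≐-trans (e⊆ , ⊆e)
          (≐-sym (subst (λ ps → _ ≐ (_∈ ps)) (sym same) e′≐))
  ... | inj₂ off with z∉ , z∈ℓ ← All.lookupAny (All.tabulate (λ z∈ → e′⊆ℓ (⊆e′ z∈))) off =
          contradiction (collinear ℓ (Any.lookup e∈E) (All.tabulate (λ z∈ → e⊆ℓ (⊆e z∈))) z∉) z∈ℓ

-- Refuting colourings by backtracking.

Assignment : ℕ → Set
Assignment k = List (ℤ² × Fin k)

Blocked : ∀ {k} → List (List ℤ²) → Assignment k → Set
Blocked E α = Any (λ e → ∃[ i ] All (λ p → (p , i) ∈ α) e) E

-- A closed search tree: a branch may close as soon as some edge is monochromatic, and otherwise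
-- splits over the colours of the next point.
Refuted : ∀ {k} → List (List ℤ²) → List ℤ² → Assignment k → Set
Refuted E []       α = Blocked E α
Refuted E (p ∷ ps) α = Blocked E α ⊎ (∀ i → Refuted E ps ((p , i) ∷ α))

blocked? : ∀ {k} E (α : Assignment k) → Dec (Blocked E α)
blocked? E α = Any.any? (λ e → Fin.any? λ i → All.all? (λ p → [ ≡-dec× _≟²_ Fin._≟_ ] (p , i) ∈? α) e) E

refuted? : ∀ {k} E ps (α : Assignment k) → Dec (Refuted E ps α)
refuted? E []       α = blocked? E α
refuted? E (p ∷ ps) α = blocked? E α ⊎-dec Fin.all? λ i → refuted? E ps ((p , i) ∷ α)

blocked-sound : ∀ {k} {E} {α : Assignment k} (f : ℤ² → Fin k) → All (λ (p , i) → f p ≡ i) α →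
                Blocked E α → Any (λ e → ∃[ i ] All (λ p → f p ≡ i) e) E
blocked-sound f agrees = Any.map λ (i , e⊆α) → i , All.map (All.lookup agrees) e⊆α

-- The colouring `f` selects one branch, along which the assignment agrees with `f`; the edge that
-- closes the branch is monochromatic under `f`.
refuted-sound : ∀ {k} {E} ps {α : Assignment k} (f : ℤ² → Fin k) → All (λ (p , i) → f p ≡ i) α →
                Refuted E ps α → Any (λ e → ∃[ i ] All (λ p → f p ≡ i) e) E
refuted-sound []       f agrees blocked        = blocked-sound f agrees blocked
refuted-sound (p ∷ ps) f agrees (inj₁ blocked) = blocked-sound f agrees blocked
refuted-sound (p ∷ ps) f agrees (inj₂ refuted) = refuted-sound ps f (refl ∷ agrees) (refuted (f p))

refuted⇒¬colorable : ∀ r S k ps → Refuted {k} (map (points r) S) ps [] →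
                     ¬ Colorable (segmentHypergraph r S) k
refuted⇒¬colorable r S k ps refuted (c , proper)
  with s , s∈S , i , mono ← find (Any.map⁻ (refuted-sound {k} ps {[]} (λ v → c v tt) [] refuted)) =
  proper {_∈ points r s} (lose s∈S ((λ v∈ → v∈) , λ v∈ → v∈)) (i , All.lookup mono)

-- The two extremal configurations.

east : Direction
east = direction (+ 1 , + 0) (+ 1 , + 0) refl

north : Direction
north = direction (+ 0 , + 1) (+ 0 , + 1) refl

northeast : Direction
northeast = direction (+ 1 , + 1) (+ 1 , + 0) refl

southeast : Direction
southeast = direction (+ 1 , -[1+ 0 ]) (+ 1 , + 0) refl

east-northeast : Direction
east-northeast = direction (+ 2 , + 1) (+ 0 , + 1) refl

east-southeast : Direction
east-southeast = direction (+ 2 , -[1+ 0 ]) (+ 0 , -[1+ 0 ]) refl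

north-northeast : Direction
north-northeast = direction (+ 1 , + 2) (+ 1 , + 0) refl

south-southeast : Direction
south-southeast = direction (+ 1 , -[1+ 1 ]) (+ 1 , + 0) refl

K₄ : List Segment
K₄ =
  ((+ 0 , + 0) , east) ∷
  ((+ 0 , + 1) , east) ∷
  ((+ 0 , + 0) , north) ∷
  ((+ 1 , + 0) , north) ∷
  ((+ 0 , + 0) , northeast) ∷
  ((+ 0 , + 1) , southeast) ∷ []

-- Found by computer search, as is the order below, which makes the backtracking prune early.
triples : List Segment
triples =
  ((+ 0 , + 3) , east) ∷
  ((+ 2 , + 2) , east) ∷
  ((+ 2 , + 4) , east) ∷
  ((+ 0 , + 2) , north) ∷
  ((+ 2 , + 2) , north) ∷
  ((+ 3 , + 2) , north) ∷
  ((+ 4 , + 0) , north) ∷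
  ((+ 0 , + 2) , northeast) ∷
  ((+ 1 , + 0) , northeast) ∷
  ((+ 2 , + 2) , northeast) ∷
  ((+ 0 , + 4) , southeast) ∷
  ((+ 2 , + 3) , southeast) ∷
  ((+ 2 , + 4) , southeast) ∷
  ((+ 0 , + 2) , east-southeast) ∷
  ((+ 0 , + 3) , east-southeast) ∷
  ((+ 1 , + 0) , north-northeast) ∷
  ((+ 2 , + 4) , south-southeast) ∷ []

K₄-order triples-order : List ℤ²
K₄-order = (+ 0 , + 0) ∷ (+ 1 , + 0) ∷ (+ 0 , + 1) ∷ (+ 1 , + 1) ∷ []
triples-order =
  (+ 4 , + 4) ∷ (+ 2 , + 4) ∷ (+ 3 , + 4) ∷ (+ 3 , + 3) ∷
  (+ 4 , + 2) ∷ (+ 3 , + 2) ∷ (+ 2 , + 2) ∷ (+ 2 , + 3) ∷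
  (+ 4 , + 0) ∷ (+ 4 , + 1) ∷ (+ 0 , + 3) ∷ (+ 1 , + 3) ∷
  (+ 0 , + 2) ∷ (+ 0 , + 4) ∷ (+ 1 , + 0) ∷ (+ 2 , + 1) ∷ []

K₄-isSegmentHypergraph : IsSegmentHypergraph 2 (segmentHypergraph 2 K₄)
K₄-isSegmentHypergraph = isSegmentHypergraph ℕ.≤-refl (from-yes (separated? 2 K₄))

triples-isSegmentHypergraph : IsSegmentHypergraph 3 (segmentHypergraph 3 triples)
triples-isSegmentHypergraph = isSegmentHypergraph (ℕ.n≤1+n 2) (from-yes (separated? 3 triples))

K₄-not-3-colorable : ¬ Colorable (segmentHypergraph 2 K₄) 3
K₄-not-3-colorable = refuted⇒¬colorable 2 K₄ 3 K₄-order
  (from-yes (refuted? {3} (map (points 2) K₄) K₄-order []))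

triples-not-2-colorable : ¬ Colorable (segmentHypergraph 3 triples) 2
triples-not-2-colorable = refuted⇒¬colorable 3 triples 2 triples-order
  (from-yes (refuted? {2} (map (points 3) triples) triples-order []))

-- The colour tables and the theorem.

-- One colour per parity class: a step that preserves the class is divisible by 2.
table₂ : Vec (Vec (Fin 4) 2) 2
table₂ = (0F ∷ 1F ∷ []) ∷
         (2F ∷ 3F ∷ []) ∷ []

-- The colour counts the coordinates that are 2 modulo 3. Over three points a coordinate that moves
-- modulo 3 is 2 exactly once, and a fixed one never or always. So the colours sum to 1 or 2 modulo
-- 3, whereas equal ones would sum to 0.
table₃ : Vec (Vec (Fin 3) 3) 3
table₃ = (0F ∷ 0F ∷ 1F ∷ []) ∷
         (0F ∷ 0F ∷ 1F ∷ []) ∷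
         (1F ∷ 1F ∷ 2F ∷ []) ∷ []

-- Modulo 4, the colour is the exclusive or of `x = 3` and `y ≥ 2`. If the step in `x` is odd, then
-- among four points `x = 3` holds once and `y ≥ 2` evenly often, so colour 1 occurs an odd number
-- of times. If it is even and the step in `y` is odd, `x = 3` has period 2 along the points, while
-- `y ≥ 2` runs through a cyclic shift of 0, 0, 1, 1 and does not.
table₄ : Vec (Vec (Fin 2) 4) 4
table₄ = (0F ∷ 0F ∷ 1F ∷ 1F ∷ []) ∷
         (0F ∷ 0F ∷ 1F ∷ 1F ∷ []) ∷
         (0F ∷ 0F ∷ 1F ∷ 1F ∷ []) ∷
         (1F ∷ 1F ∷ 0F ∷ 0F ∷ []) ∷ []

colorable₂ : ∀ {H} → IsSegmentHypergraph 2 H → Colorable H 4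
colorable₂ = multicoloured⇒colorable table₂ ℕ.≤-refl ℕ.∣-refl
  (from-yes (multicoloured? table₂ 2 2)) ℕ.≤-refl

colorable₃ : ∀ {H} → IsSegmentHypergraph 3 H → Colorable H 3
colorable₃ = multicoloured⇒colorable table₃ (ℕ.n≤1+n 2) ℕ.∣-refl
  (from-yes (multicoloured? table₃ 3 3)) ℕ.≤-refl

colorable₄ : ∀ {r H} → 4 ≤ r → IsSegmentHypergraph r H → Colorable H 2
colorable₄ = multicoloured⇒colorable table₄ ℕ.≤-refl (ℕ.divides 2 refl)
  (from-yes (multicoloured? table₄ 2 4))

theorem2p2 : (∀ (r : ℕ) (H : Hypergraph ℤ²) → IsSegmentHypergraph r H →
    (r ≡ 2 → χ[ H ]≤ 4) ×
    (r ≡ 3 → χ[ H ]≤ 3) ×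
    (4 ≤ r → χ[ H ]≤ 2 × (Satisfiable (Hypergraph.E H) → χ[ H ]≡ 2))) ×
    (∃[ H ] (IsSegmentHypergraph 2 H × χ[ H ]≡ 4)) ×
    (∃[ H ] (IsSegmentHypergraph 3 H × χ[ H ]≡ 3))
theorem2p2 =
  (λ r H H-seg →
    (λ where refl → χ≤-from-colorable H (s≤s z≤n) (colorable₂ H-seg)) ,
    (λ where refl → χ≤-from-colorable H (s≤s z≤n) (colorable₃ H-seg)) ,
    λ 4≤r → χ≤-from-colorable H (s≤s z≤n) (colorable₄ 4≤r H-seg) ,
      λ nonempty → χ≡-from-colorable H (colorable₄ 4≤r H-seg) (edge⇒¬1-colorable H nonempty)) ,
  (_ , K₄-isSegmentHypergraph ,
    χ≡-from-colorable (segmentHypergraph 2 K₄) (colorable₂ K₄-isSegmentHypergraph) K₄-not-3-colorable) ,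
  (_ , triples-isSegmentHypergraph ,
    χ≡-from-colorable (segmentHypergraph 3 triples) (colorable₃ triples-isSegmentHypergraph) triples-not-2-colorable)
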